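{- Let $i\ge2$, $j\ge1$ and $k\ge1$ be integers and let $x=(10)^i0(10)^j0(10)^k$. Then $[x]_2\notin R$.
   Context: Stern's sequence $(a(n))_{n\ge0}$: $a(0)=0$, $a(1)=1$, $a(2n)=a(n)$, $a(2n+1)=a(n)+a(n+1)$; $s(n)=a(n+1)$. $R$ is the set of record-setters of $s$, i.e. indices $v\ge0$ with $s(i)<s(v)$ for all $i<v$. For a binary string $x$, $[x]_2$ is the integer it represents in base 2; $x^i$ denotes $i$-fold concatenation. -}

module Defs where

open import Data.Digit using (Bit; 0b; 1b; fromDigits)
open import Data.List.Base using (List; []; _∷_; concat; replicate; reverse)
open import Data.Nat.Base
open import Data.Nat.Properties
open import Data.Parity.Base using (Parity; 0ℙ; 1ℙ)
open import Level using (0ℓ)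
open import Relation.Binary.PropositionalEquality
open import Relation.Unary using (Pred)

-- The first argument bounds the recursion depth; any bound ≥ the index gives
-- the same value (sternFuel-irrelevant).  The index 2 + m is 2 (1 + ⌊ m /2⌋)
-- or 2 (1 + ⌊ m /2⌋) + 1 according to the parity of m.
mutual
  sternFuel : ℕ → ℕ → ℕ
  sternFuel _       0             = 0
  sternFuel _       1             = 1
  sternFuel zero    (suc (suc m)) = 0
  sternFuel (suc f) (suc (suc m)) = sternStep f (parity m) (suc ⌊ m /2⌋)

  sternStep : ℕ → Parity → ℕ → ℕ
  sternStep f 0ℙ h = sternFuel f h
  sternStep f 1ℙ h = sternFuel f h + sternFuel f (suc h)

a : ℕ → ℕ
a n = sternFuel n n

s : ℕ → ℕ
s n = a (suc n)

R : Pred ℕ 0ℓ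
R v = ∀ i → i < v → s i < s v

-- Binary strings are written most significant bit first, whereas fromDigits
-- expects the least significant digit first.
[_]₂ : List Bit → ℕ
[ x ]₂ = fromDigits (reverse x)

infixr 8 _^ˢ_

_^ˢ_ : List Bit → ℕ → List Bit
x ^ˢ i = concat (replicate i x)

‵0 ‵10 : List Bit
‵0  = 0b ∷ []
‵10 = 1b ∷ 0b ∷ []

private
  odd-bound : ∀ m {f} → parity m ≡ 1ℙ → suc m ≤ f → suc (suc ⌊ m /2⌋) ≤ f
  odd-bound (suc m) _ m<f = ≤-trans (s≤s (s≤s (half m))) m<f
    where
    half : ∀ n → ⌊ suc n /2⌋ ≤ n
    half zero    = z≤n
    half (suc n) = s≤s (⌊n/2⌋≤n n)

sternFuel-irrelevant : ∀ f g n → n ≤ f → n ≤ g → sternFuel f n ≡ sternFuel g n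
sternFuel-irrelevant _ _ 0 _ _ = refl
sternFuel-irrelevant _ _ 1 _ _ = refl
sternFuel-irrelevant (suc f) (suc g) (suc (suc m)) (s≤s m<f) (s≤s m<g)
  with parity m in eq
... | 0ℙ = sternFuel-irrelevant f g _ (≤-trans (s≤s (⌊n/2⌋≤n m)) m<f)
                                      (≤-trans (s≤s (⌊n/2⌋≤n m)) m<g)
... | 1ℙ = cong₂ _+_
  (sternFuel-irrelevant f g _ (≤-trans (s≤s (⌊n/2⌋≤n m)) m<f)
                              (≤-trans (s≤s (⌊n/2⌋≤n m)) m<g))
  (sternFuel-irrelevant f g _ (odd-bound m eq m<f) (odd-bound m eq m<g))

private
  parity-even : ∀ n → parity (n + n) ≡ 0ℙ
  parity-even zero = refl
  parity-even (suc n) rewrite +-suc n n = parity-even n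

  parity-odd : ∀ n → parity (suc (n + n)) ≡ 1ℙ
  parity-odd zero = refl
  parity-odd (suc n) rewrite +-suc n n = parity-odd n

  half-odd : ∀ n → ⌊ suc (n + n) /2⌋ ≡ n
  half-odd zero = refl
  half-odd (suc n) rewrite +-suc n n = cong suc (half-odd n)

a-zero : a 0 ≡ 0
a-zero = refl

a-one : a 1 ≡ 1
a-one = refl

a-even : ∀ n → a (2 * n) ≡ a n
a-even zero = refl
a-even (suc n)
  rewrite +-identityʳ n | +-suc n n | parity-even n | sym (n≡⌊n+n/2⌋ n)
  = sternFuel-irrelevant (suc (n + n)) (suc n) (suc n) (s≤s (m≤m+n n n)) ≤-refl

a-odd : ∀ n → a (2 * n + 1) ≡ a n + a (n + 1)
a-odd zero = refl
a-odd (suc n)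
  rewrite +-identityʳ n | +-comm (n + suc n) 1 | +-suc n n | +-comm n 1
        | parity-odd n | half-odd n
  = cong₂ _+_
      (sternFuel-irrelevant (suc (suc (n + n))) (suc n) (suc n)
        (s≤s (m≤n⇒m≤1+n (m≤m+n n n))) ≤-refl)
      (sternFuel-irrelevant (suc (suc (n + n))) (suc (suc n)) (suc (suc n))
        (s≤s (s≤s (m≤m+n n n))) ≤-refl)

{-# OPTIONS --safe #-}
-- Reading a bit maps the pair (a n , a (n + 1)) to its value at 2n or 2n + 1,
-- so s [ x ]₂ is computed by a product of 2 × 2 matrices, the block 10 giving
-- the matrix with entries F₁, F₂, F₂, F₃.  With this, the smaller number
-- (10)^(i-1) 0 (10)^(j+1) (10)^k 0 of the same length as (10)^i 0 (10)^j 0 (10)^k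
-- is seen to have at least the same value of s.
module Submission where

open import Defs
open import Data.Digit using (Bit; 0b; fromDigits)
open import Data.Fin.Base using (toℕ; zero; suc)
open import Data.Fin.Properties using (toℕ≤pred[n])
open import Data.List.Base using (List; []; _∷_; _++_; foldl; foldr; length; reverse)
open import Data.List.Properties using (foldl-++; length-++; length-++-comm; reverse-foldr)
open import Data.Nat.Base using (ℕ; zero; suc; _+_; _*_; _≤_; _<_; _≥_; s≤s)
open import Data.Nat.Properties
open import Data.Nat.Tactic.RingSolver using (solve-∀)
open import Data.Product.Base using (_×_; _,_; proj₂)
open import Relation.Binary.PropositionalEquality
open import Relation.Unary using (_∉_)

appendBit : ℕ → Bit → ℕ
appendBit n b = toℕ b + n * 2

[]₂-foldl : ∀ xs → [ xs ]₂ ≡ foldl appendBit 0 xs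
[]₂-foldl xs = trans (unfold (reverse xs)) (reverse-foldr _ 0 xs)
  where
  unfold : ∀ ys → fromDigits ys ≡ foldr (λ b n → appendBit n b) 0 ys
  unfold []       = refl
  unfold (b ∷ ys) = cong (λ n → appendBit n b) (unfold ys)

-- Doubling turns a strict inequality into a gap of at least 2, while two appended bits differ by at
-- most 1.
appendBit-mono-< : ∀ {m n} b c → m < n → appendBit m b < appendBit n c
appendBit-mono-< {m} {n} b c m<n = begin-strict
  toℕ b + m * 2  ≤⟨ +-monoˡ-≤ (m * 2) (toℕ≤pred[n] b) ⟩
  1 + m * 2      <⟨ n<1+n _ ⟩
  suc m * 2      ≤⟨ *-monoˡ-≤ 2 m<n ⟩
  n * 2          ≤⟨ m≤n+m (n * 2) (toℕ c) ⟩
  toℕ c + n * 2  ∎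
  where open ≤-Reasoning

foldl-appendBit-mono-< : ∀ {m n} xs ys → length xs ≡ length ys → m < n →
  foldl appendBit m xs < foldl appendBit n ys
foldl-appendBit-mono-< []       []       _  m<n = m<n
foldl-appendBit-mono-< (x ∷ xs) (y ∷ ys) eq m<n =
  foldl-appendBit-mono-< xs ys (suc-injective eq) (appendBit-mono-< x y m<n)

-- After `i` common blocks one string continues with 0 and the other with 1. This first disagreement
-- decides, since the remainders `xs` and `0b ∷ ys` have equal length.
shorter-10-prefix-< : ∀ n i xs ys → length xs ≡ suc (length ys) →
  foldl appendBit n (‵10 ^ˢ i ++ ‵0 ++ xs) < foldl appendBit n (‵10 ^ˢ suc i ++ ys)
shorter-10-prefix-< n zero    xs ys eq = foldl-appendBit-mono-< xs (0b ∷ ys) eq (n<1+n _)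
shorter-10-prefix-< n (suc i) xs ys eq = shorter-10-prefix-< _ i xs ys eq

sternPair : ℕ → ℕ × ℕ
sternPair n = a n , a (suc n)

step : ℕ × ℕ → Bit → ℕ × ℕ
step (p , q) zero    = p , p + q
step (p , q) (suc _) = p + q , q

a-double : ∀ n → a (n * 2) ≡ a n
a-double n = trans (cong a (*-comm n 2)) (a-even n)

a-suc-double : ∀ n → a (suc (n * 2)) ≡ a n + a (suc n)
a-suc-double n = begin
  a (suc (n * 2))  ≡⟨ cong a (trans (+-comm 1 (n * 2)) (cong (_+ 1) (*-comm n 2))) ⟩
  a (2 * n + 1)    ≡⟨ a-odd n ⟩
  a n + a (n + 1)  ≡⟨ cong (λ m → a n + a m) (+-comm n 1) ⟩
  a n + a (suc n)  ∎
  where open ≡-Reasoning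

sternPair-appendBit : ∀ n b → sternPair (appendBit n b) ≡ step (sternPair n) b
sternPair-appendBit n zero       = cong₂ _,_ (a-double n) (a-suc-double n)
-- For the bit 1 the second index 2n + 2 is definitionally `suc n * 2`.
sternPair-appendBit n (suc zero) = cong₂ _,_ (a-suc-double n) (a-double (suc n))

sternPair-foldl : ∀ n xs → sternPair (foldl appendBit n xs) ≡ foldl step (sternPair n) xs
sternPair-foldl n []       = refl
sternPair-foldl n (x ∷ xs) = trans (sternPair-foldl (appendBit n x) xs)
  (cong (λ v → foldl step v xs) (sternPair-appendBit n x))

-- The Fibonacci numbers F₂ₙ₋₁ and F₂ₙ (with F₋₁ = 1).
mutual
  fibOdd : ℕ → ℕ
  fibOdd zero    = 1
  fibOdd (suc n) = fibOdd n + fibEven n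

  fibEven : ℕ → ℕ
  fibEven zero    = 0
  fibEven (suc n) = fibOdd n + 2 * fibEven n

-- The n-th power of the matrix of the block 10, with entries F₂ₙ₋₁, F₂ₙ, F₂ₙ, F₂ₙ₊₁.
power10 : ℕ → ℕ × ℕ → ℕ × ℕ
power10 n (p , q) = fibOdd n * p + fibEven n * q , fibEven n * p + (fibOdd n + fibEven n) * q

foldl-step-10 : ∀ n p q → foldl step (p , q) (‵10 ^ˢ n) ≡ power10 n (p , q)
foldl-step-10 zero    p q = cong₂ _,_ (base₁ p q) (base₂ q)
  where
  base₁ : ∀ p q → p ≡ 1 * p + 0 * q
  base₁ = solve-∀
  base₂ : ∀ q → q ≡ 1 * q
  base₂ = solve-∀
foldl-step-10 (suc n) p q =
  trans (foldl-step-10 n (p + q) (p + q + q))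
        (cong₂ _,_ (step₁ (fibOdd n) (fibEven n) p q) (step₂ (fibOdd n) (fibEven n) p q))
  where
  step₁ : ∀ f g p q → f * (p + q) + g * (p + q + q) ≡ (f + g) * p + (f + 2 * g) * q
  step₁ = solve-∀
  step₂ : ∀ f g p q → g * (p + q) + (f + g) * (p + q + q)
                    ≡ (f + 2 * g) * p + (f + g + (f + 2 * g)) * q
  step₂ = solve-∀

foldl-step-10-++ : ∀ n v xs → foldl step v (‵10 ^ˢ n ++ xs) ≡ foldl step (power10 n v) xs
foldl-step-10-++ n v@(p , q) xs = trans (foldl-++ step v (‵10 ^ˢ n) xs)
  (cong (λ w → foldl step w xs) (foldl-step-10 n p q))

-- `competitor i` is to be compared with `original (suc i)`. Its (10)^(j+1) and (10)^k stay apart,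
-- so that their matrices enter as two factors and no addition formula for Fibonacci numbers comes
-- in.
original competitor : ℕ → ℕ → ℕ → List Bit
original   i j k = ‵10 ^ˢ i ++ ‵0 ++ ‵10 ^ˢ j ++ ‵0 ++ ‵10 ^ˢ k
competitor i j k = ‵10 ^ˢ i ++ ‵0 ++ ‵10 ^ˢ suc j ++ ‵10 ^ˢ k ++ ‵0

append0 : ℕ × ℕ → ℕ × ℕ
append0 v = step v 0b

foldl-step-original : ∀ i j k v →
  foldl step v (original i j k) ≡ power10 k (append0 (power10 j (append0 (power10 i v))))
foldl-step-original i j k v = begin
  foldl step v (original i j k)
    ≡⟨ foldl-step-10-++ i v _ ⟩
  foldl step (append0 (power10 i v)) (‵10 ^ˢ j ++ ‵0 ++ ‵10 ^ˢ k)
    ≡⟨ foldl-step-10-++ j _ _ ⟩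
  foldl step (append0 (power10 j (append0 (power10 i v)))) (‵10 ^ˢ k)
    ≡⟨ foldl-step-10 k _ _ ⟩
  power10 k (append0 (power10 j (append0 (power10 i v)))) ∎
  where open ≡-Reasoning

foldl-step-competitor : ∀ i j k v →
  foldl step v (competitor i j k) ≡ append0 (power10 k (power10 (suc j) (append0 (power10 i v))))
foldl-step-competitor i j k v = begin
  foldl step v (competitor i j k)
    ≡⟨ foldl-step-10-++ i v _ ⟩
  foldl step (append0 (power10 i v)) (‵10 ^ˢ suc j ++ ‵10 ^ˢ k ++ ‵0)
    ≡⟨ foldl-step-10-++ (suc j) _ _ ⟩
  foldl step (power10 (suc j) (append0 (power10 i v))) (‵10 ^ˢ k ++ ‵0)
    ≡⟨ foldl-step-10-++ k _ _ ⟩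
  append0 (power10 k (power10 (suc j) (append0 (power10 i v)))) ∎
  where open ≡-Reasoning

power10-suc : ∀ i → let t = fibOdd i + fibEven i ; r = fibEven i in
  power10 (suc i) (0 , 1) ≡ (t + r , 2 * t + r)
power10-suc i = cong₂ _,_ (eq₁ (fibOdd i) (fibEven i)) (eq₂ (fibOdd i) (fibEven i))
  where
  eq₁ : ∀ f g → (f + g) * 0 + (f + 2 * g) * 1 ≡ f + g + g
  eq₁ = solve-∀
  eq₂ : ∀ f g → (f + 2 * g) * 0 + (f + g + (f + 2 * g)) * 1 ≡ 2 * (f + g) + g
  eq₂ = solve-∀

-- Using the same t = F₂ᵢ₊₁ and r = F₂ᵢ as `power10-suc` makes both values of `s` polynomials in
-- common variables.
power10-2+ : ∀ i → let t = fibOdd i + fibEven i ; r = fibEven i in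
  power10 (2 + i) (0 , 1) ≡ (3 * t + 2 * r , 5 * t + 3 * r)
power10-2+ i = trans (power10-suc (suc i))
  (cong₂ _,_ (eq₁ (fibOdd i) (fibEven i)) (eq₂ (fibOdd i) (fibEven i)))
  where
  eq₁ : ∀ f g → f + g + (f + 2 * g) + (f + 2 * g) ≡ 3 * (f + g) + 2 * g
  eq₁ = solve-∀
  eq₂ : ∀ f g → 2 * (f + g + (f + 2 * g)) + (f + 2 * g) ≡ 5 * (f + g) + 3 * g
  eq₂ = solve-∀

-- Here (t + r , 2 t + r) is the state after (10)^(i-1), where t = F₂ᵢ₋₃ and
-- r = F₂ᵢ₋₄; writing it this way, and F₂ₖ₋₁ = f + g, F₂ₖ = f + 2 g with
-- g = F₂ₖ₋₂, makes all coefficients of the excess nonnegative.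
competitor-excess : ∀ t r a b f g →
  let x  = 3 * t + 2 * r
      y  = x + (5 * t + 3 * r)
      u  = a * x + b * y
      w  = u + (b * x + (a + b) * y)
      x′ = t + r
      y′ = x′ + (2 * t + r)
      u′ = (a + b) * x′ + (a + 2 * b) * y′
      w′ = (a + 2 * b) * x′ + (a + b + (a + 2 * b)) * y′
      d  = f + g
      e  = f + 2 * g
  in (d * u′ + e * w′) + (e * u′ + (d + e) * w′)
     ≡ (e * u + (d + e) * w)
       + (d * (a * (4 * t + 5 * r) + b * (t + 5 * r)) + g * (4 * a * (t + r) + b * (2 * t + 4 * r)))
competitor-excess = solve-∀

-- The fold starts at the number 0, whose pair is (a 0 , a 1) = (0 , 1); the shift in `s` selects
-- the second component.
s-foldl : ∀ xs → s [ xs ]₂ ≡ proj₂ (foldl step (0 , 1) xs)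
s-foldl xs = trans (cong s ([]₂-foldl xs)) (cong proj₂ (sternPair-foldl 0 xs))

s-original≤s-competitor : ∀ i j k →
  s [ original (2 + i) j (suc k) ]₂ ≤ s [ competitor (suc i) j (suc k) ]₂
s-original≤s-competitor i j k = begin
  s [ original (2 + i) j (suc k) ]₂
    ≡⟨ s-foldl (original (2 + i) j (suc k)) ⟩
  proj₂ (foldl step (0 , 1) (original (2 + i) j (suc k)))
    ≡⟨ cong proj₂ (foldl-step-original (2 + i) j (suc k) (0 , 1)) ⟩
  proj₂ (afterOriginal (power10 (2 + i) (0 , 1)))
    ≡⟨ cong (λ v → proj₂ (afterOriginal v)) (power10-2+ i) ⟩
  proj₂ (afterOriginal (3 * t + 2 * r , 5 * t + 3 * r))
    -- The summand added here is the excess, found by unification with `competitor-excess`. There (u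
    -- , w) is the state after the second lone 0 of the original, and (u′ , w′) the state after
    -- (10)^(j+1) in the competitor.
    ≤⟨ m≤m+n _ _ ⟩
  _
    ≡⟨ competitor-excess t r (fibOdd j) (fibEven j) (fibOdd k) (fibEven k) ⟨
  proj₂ (afterCompetitor (t + r , 2 * t + r))
    ≡⟨ cong (λ v → proj₂ (afterCompetitor v)) (power10-suc i) ⟨
  proj₂ (afterCompetitor (power10 (suc i) (0 , 1)))
    ≡⟨ cong proj₂ (foldl-step-competitor (suc i) j (suc k) (0 , 1)) ⟨
  proj₂ (foldl step (0 , 1) (competitor (suc i) j (suc k)))
    ≡⟨ s-foldl (competitor (suc i) j (suc k)) ⟨
  s [ competitor (suc i) j (suc k) ]₂ ∎
  where
  open ≤-Reasoning
  t r : ℕ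
  t = fibOdd i + fibEven i
  r = fibEven i
  afterOriginal afterCompetitor : ℕ × ℕ → ℕ × ℕ
  afterOriginal   v = power10 (suc k) (append0 (power10 j (append0 v)))
  afterCompetitor v = append0 (power10 (suc k) (power10 (suc j) (append0 v)))

competitor<original : ∀ i j k → [ competitor i j k ]₂ < [ original (suc i) j k ]₂
competitor<original i j k = subst₂ _<_
  (sym ([]₂-foldl (competitor i j k))) (sym ([]₂-foldl (original (suc i) j k)))
  -- The two successors are, on the left, the additional block of (10)^(j+1) and, on the right, the
  -- first lone 0 together with the 0 completing the last block of (10)^(i+1).
  (shorter-10-prefix-< 0 i _ _ (cong (λ n → suc (suc n)) lengths))
  where
  open ≡-Reasoning
  js ks : List Bit
  js = ‵10 ^ˢ j
  ks = ‵10 ^ˢ k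
  lengths : length (js ++ ks ++ ‵0) ≡ length (js ++ ‵0 ++ ks)
  lengths = begin
    length (js ++ ks ++ ‵0)           ≡⟨ length-++ js ⟩
    length js + length (ks ++ ‵0)     ≡⟨ cong (length js +_) (length-++-comm ks ‵0) ⟩
    length js + length (‵0 ++ ks)     ≡⟨ length-++ js ⟨
    length (js ++ ‵0 ++ ks)           ∎

mainTheorem17 : (i j k : ℕ) → i ≥ 2 → j ≥ 1 → k ≥ 1 →
    [ ‵10 ^ˢ i ++ ‵0 ++ ‵10 ^ˢ j ++ ‵0 ++ ‵10 ^ˢ k ]₂ ∉ R
-- The bounds on i and k make r = F₂ᵢ₋₄ and g = F₂ₖ₋₂ natural numbers; at i = 1 or k = 0 the index
-- would be -2, with F₋₂ = -1. A tie at a smaller index already refutes a strict record.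
mainTheorem17 (suc (suc i)) j (suc k) (s≤s (s≤s _)) _ (s≤s _) record-setter =
  <⇒≱ (record-setter _ (competitor<original (suc i) j (suc k))) (s-original≤s-competitor i j k)
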